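{- Let $\mu$ be a partition of $n$ and consider its modified GP-tree. Every filling at Level 0 is a row-strict filling of $\mu$, and for each Level 0 filling $T$, $\Phi(T)$ equals the monomial labelling the Level B leaf below $T$.
   Context: Compositions: sequences of nonnegative integers summing to $n$, drawn with $\rho_k$ left-justified boxes in row $k$ (rows top to bottom). Row-strict filling: bijective placement of $1,\dots,n$ with entries increasing left to right in rows. Dimension-ordering of a composition with $r$ nonzero rows: label the far-right boxes of nonzero rows $1,\dots,r$, ordering them by column from rightmost to leftmost, and within a column top to bottom. Modified GP-tree of $\mu$: Level $n$ has the single vertex $\mu$ with no boxes filled. A vertex at Level $i$ ($1\le i\le n$) is $\mu$ with the values $i+1,\dots,n$ placed in some boxes, such that the unfilled boxes in each row form an initial (leftmost) segment, i.e. the unfilled boxes form a composition $\mu^{(i)}$ of $i$. If $\mu^{(i)}$ has $r$ nonzero rows, the vertex has $r$ children at Level $i-1$, joined by edges labelled $x_i^0,x_i^1,\dots,x_i^{r-1}$ (left to right); the child along edge $x_i^j$ is obtained by imposing the dimension-ordering on $\mu^{(i)}$ and placing the value $i$ into the unfilled box with label $j+1$. Level 0 thus consists of complete fillings of $\mu$; each Level 0 vertex has a unique child leaf at Level B joined by an edge labelled $1$, and each leaf is labelled by the product of all edge labels on the path from the root. Dimension pairs (with $h(j)=j$): $(a,b)$ is a dimension pair of a filling $T$ if $b>a$; $b$ lies in the same column as $a$ strictly below it or in a column strictly left of $a$'s; and if a box immediately right of $a$ contains $c$, then $b\le c$. $\Phi(T)=\prod_{j=2}^n x_j^{|D^T_j|}$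 where $D^T_j$ is the set of dimension pairs $(a,j)$. -}

module Defs where

open import Data.Bool.Properties using (T?)
open import Data.Fin as Fin using (Fin; toℕ)
import Data.Fin.Properties as Fin
open import Data.List using (List; length; map; filter; foldr; concatMap; allFin; applyUpTo; downFrom)
import Data.List as List
open import Data.Maybe using (Maybe; just; nothing; is-nothing)
open import Data.Nat using (ℕ; zero; suc; _+_; _∸_; _≤_; _<_; _≥_; _≟_; _≤?_; _<?_)
open import Data.Product using (∃; ∃-syntax; _×_; _,_)
open import Data.Product.Properties using (≡-dec)
open import Data.Sum using (_⊎_)
open import Data.Vec using (Vec; lookup; sum; tabulate)
open import Data.Vec.Relation.Unary.All using (All)
open import Data.Vec.Relation.Unary.Linked using (Linked)
open import Function.Definitions using (Injective)
open import Relation.Binary.PropositionalEquality using (_≡_)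
open import Relation.Nullary using (Dec; yes; no)
open import Relation.Nullary.Decidable using (map′; _×-dec_; _⊎-dec_; _→-dec_)
open import Relation.Unary using (Decidable)

[_⋯_] : ℕ → ℕ → List ℕ
[ a ⋯ b ] = applyUpTo (a +_) (suc b ∸ a)

------------------------------------------------------------------------
-- Compositions, partitions, diagrams

-- A composition of sum α into k (possibly empty) rows, listed top to bottom.
Composition : ℕ → Set
Composition k = Vec ℕ k

record IsPartition {k} (n : ℕ) (μ : Composition k) : Set where
  field
    sums-to    : sum μ ≡ n
    positive   : All (0 <_) μ
    decreasing : Linked _≥_ μ

-- Rows are numbered from the top and columns from the left, both from 0.
record Box {k} (α : Composition k) : Set where
  constructor box
  field
    row    : Fin k
    column : Fin (lookup α row)

  col : ℕ
  col = toℕ column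

  position : Fin k × ℕ
  position = row , col

open Box public

module _ {k} {α : Composition k} where

  anyBox? : {P : Box α → Set} → Decidable P → Dec (∃ P)
  anyBox? P? = map′ (λ { (r , c , p) → box r c , p }) (λ { (box r c , p) → r , c , p })
    (Fin.any? λ r → Fin.any? λ c → P? (box r c))

  allBox? : {P : Box α → Set} → Decidable P → Dec (∀ b → P b)
  allBox? P? = map′ (λ { h (box r c) → h r c }) (λ h r c → h (box r c))
    (Fin.all? λ r → Fin.all? λ c → P? (box r c))

-- The far-right boxes of the nonzero rows of α: columns from rightmost to
-- leftmost, top to bottom within a column.  The box with label j + 1 is the
-- entry at index j, and the length is the number of nonzero rows.
dimensionOrdering : ∀ {k} → Composition k → List (Fin k × ℕ)
dimensionOrdering {k} α =
  concatMap (λ c → map (_, c) (filter (λ r → lookup α r ≟ suc c) (allFin k)))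
            (downFrom (sum α))

------------------------------------------------------------------------
-- Fillings

Filling : ∀ {k} → Composition k → Set
Filling μ = Box μ → ℕ

record IsRowStrictFilling {k} {μ : Composition k} (n : ℕ) (T : Filling μ) : Set where
  field
    in-range   : ∀ b → 1 ≤ T b × T b ≤ n
    injective  : Injective _≡_ _≡_ T
    surjective : ∀ v → 1 ≤ v → v ≤ n → ∃[ b ] T b ≡ v
    row-strict : ∀ r {c d} → c Fin.< d → T (box r c) < T (box r d)

-- Unfilled boxes are sent to nothing.
PartialFilling : ∀ {k} → Composition k → Set
PartialFilling μ = Box μ → Maybe ℕ

module _ {k} {μ : Composition k} where

  -- The composition formed by the unfilled boxes, which are left-justified in
  -- every vertex of the tree below.
  unfilled : PartialFilling μ → Composition k
  unfilled f = tabulate λ r →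
    length (filter (λ c → T? (is-nothing (f (box r c)))) (allFin (lookup μ r)))

  place : ℕ → Fin k × ℕ → PartialFilling μ → PartialFilling μ
  place v p f b with ≡-dec Fin._≟_ _≟_ (position b) p
  ... | yes _ = just v
  ... | no  _ = f b

------------------------------------------------------------------------
-- Monomials in the variables x₁, x₂, …, as exponent functions

Monomial : Set
Monomial = ℕ → ℕ

one : Monomial
one _ = 0

infixl 7 _·_
_·_ : Monomial → Monomial → Monomial
(m · m′) i = m i + m′ i

x[_]^_ : ℕ → ℕ → Monomial
(x[ j ]^ e) i with i ≟ j
... | yes _ = e
... | no  _ = 0

∏ : List Monomial → Monomial
∏ = foldr _·_ one

------------------------------------------------------------------------
-- The modified GP-tree

-- Vertex n μ i f: the vertices at Level i whose partial filling is f.  An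
-- element records the path from the root, so distinct vertices stay distinct.
data Vertex {k} (n : ℕ) (μ : Composition k) : ℕ → PartialFilling μ → Set where
  root  : Vertex n μ n (λ _ → nothing)
  child : ∀ {i f} → Vertex n μ (suc i) f →
          (j : Fin (length (dimensionOrdering (unfilled f)))) →
          Vertex n μ i (place (suc i) (List.lookup (dimensionOrdering (unfilled f)) j) f)

pathLabel : ∀ {k n i} {μ : Composition k} {f} → Vertex n μ i f → Monomial
pathLabel root                = one
pathLabel (child {i = i} v j) = pathLabel v · (x[ suc i ]^ toℕ j)

-- The label of the Level B leaf below v; its last edge is labelled 1.
leafLabel : ∀ {k n} {μ : Composition k} {f} → Vertex n μ 0 f → Monomial
leafLabel v = pathLabel v · one

------------------------------------------------------------------------
-- Dimension pairs (for h(j) = j) and Φ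

module _ {k} {μ : Composition k} (T : Filling μ) where

  IsDimensionPair : ℕ × ℕ → Set
  IsDimensionPair (a , b) = ∃[ p ] ∃[ q ]
    T p ≡ a × T q ≡ b × a < b ×
    ((col q ≡ col p × row p Fin.< row q) ⊎ col q < col p) ×
    (∀ s → position s ≡ (row p , suc (col p)) → b ≤ T s)

  isDimensionPair? : Decidable IsDimensionPair
  isDimensionPair? (a , b) = anyBox? λ p → anyBox? λ q →
    (T p ≟ a) ×-dec (T q ≟ b) ×-dec (a <? b) ×-dec
    (((col q ≟ col p) ×-dec (row p Fin.<? row q)) ⊎-dec (col q <? col p)) ×-dec
    allBox? λ s → ≡-dec Fin._≟_ _≟_ (position s) (row p , suc (col p)) →-dec (b ≤? T s)

  -- The set D^T_j, as a list without repetitions.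
  D : ℕ → ℕ → List (ℕ × ℕ)
  D n j = filter isDimensionPair? (map (_, j) [ 1 ⋯ n ])

  Φ : ℕ → Monomial
  Φ n = ∏ (map (λ j → x[ j ]^ length (D n j)) [ 2 ⋯ n ])

{-# OPTIONS --safe #-}

-- A box p of the filling T with T p < b forms a dimension pair (T p , b)
-- exactly when p was the far-right unfilled box of its row at the moment b was
-- placed and p precedes the box of b in the dimension-ordering: the condition
-- b ≤ c on the right neighbour says that this neighbour was already filled, or
-- is filled by b itself, which the position condition excludes.  Hence the
-- exponent of x_b, the number of far-right boxes preceding the chosen one, is
-- the number of dimension pairs (a , b).

module Submission where

open import Defs
open import Data.Bool using (T)
open import Data.Bool.Properties using (T?)
open import Data.Fin as Fin using (Fin; toℕ; fromℕ<; zero; suc)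
import Data.Fin.Properties as Fin
open import Data.List as List using (List; []; _∷_; _++_; length; filter; allFin; downFrom)
open import Data.List.Membership.Propositional using (_∈_; _∉_; find; lose)
open import Data.List.Membership.Propositional.Properties
open import Data.List.Properties
  using (filter-accept; filter-reject; filter-none; length-++)
open import Data.List.Relation.Unary.All as All using (All; []; _∷_)
import Data.List.Relation.Unary.All.Properties as All
open import Data.List.Relation.Unary.AllPairs as AllPairs using (AllPairs; []; _∷_)
import Data.List.Relation.Unary.AllPairs.Properties as AllPairs
open import Data.List.Relation.Unary.Any using (here; there)
open import Data.List.Relation.Unary.Unique.Propositional using (Unique)
import Data.List.Relation.Unary.Unique.Propositional.Properties as Unique
open import Data.Maybe using (Maybe; just; nothing; is-nothing)
open import Data.Maybe.Properties using (just-injective)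
open import Data.Nat
open import Data.Nat.Properties
open import Data.Product using (Σ-syntax; ∃-syntax; _×_; _,_; proj₁; proj₂)
open import Data.Product.Properties using (≡-dec)
open import Data.Sum using (_⊎_; inj₁; inj₂)
open import Data.Unit using (tt)
open import Data.Vec using ([]; _∷_; lookup; sum; _[_]≔_)
open import Data.Vec.Properties
  using (tabulate∘lookup; tabulate-cong; lookup∘update; lookup∘update′)
open import Function using (_∘_; id; flip)
open import Level using (0ℓ)
open import Relation.Binary using (Rel; Asymmetric)
import Relation.Binary as Binary
open import Relation.Binary.PropositionalEquality
open import Relation.Nullary using (Dec; ¬_; yes; no)
open import Relation.Nullary.Decidable using (_×-dec_; _⊎-dec_)
open import Relation.Nullary.Negation using (contradiction)
open import Relation.Unary using (Decidable)

-- Counting in lists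

module _ {A B : Set} (R : A → B → Set) where

  -- Induction on `xs`: the partner of the head is deleted from `ys`, and every other element keeps
  -- its partner, since injectivity of `R` would identify it with the head. Two such comparisons
  -- later replace an explicit bijection.
  length-≤ : (∀ {x x′ y} → R x y → R x′ y → x ≡ x′) →
             ∀ {xs ys} → Unique xs → (∀ {x} → x ∈ xs → ∃[ y ] y ∈ ys × R x y) →
             length xs ≤ length ys
  length-≤ inj {[]}     []            total = z≤n
  length-≤ inj {x ∷ xs} (x∉xs ∷ xs!) total with total (here refl)
  ... | y , y∈ys , Rxy with ∈-∃++ y∈ys
  ... | us , vs , refl = begin
    suc (length xs)               ≤⟨ s≤s (length-≤ inj xs! rest) ⟩
    suc (length (us ++ vs))       ≡⟨ cong suc (length-++ us) ⟩
    suc (length us + length vs)   ≡⟨ +-suc (length us) (length vs) ⟨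
    length us + suc (length vs)   ≡⟨ length-++ us ⟨
    length (us ++ y ∷ vs)         ∎
    where
    open ≤-Reasoning
    rest : ∀ {x′} → x′ ∈ xs → ∃[ y′ ] y′ ∈ us ++ vs × R x′ y′
    rest x′∈xs with total (there x′∈xs)
    ... | y′ , y′∈ , Rx′y′ with ∈-++⁻ us y′∈
    ... | inj₁ y′∈us         = y′ , ∈-++⁺ˡ y′∈us , Rx′y′
    ... | inj₂ (there y′∈vs) = y′ , ∈-++⁺ʳ us y′∈vs , Rx′y′
    ... | inj₂ (here refl)   = contradiction (inj Rxy Rx′y′) (All.lookup x∉xs x′∈xs)

module _ {A : Set} {_<′_ : Rel A 0ℓ} (_<′?_ : Binary.Decidable _<′_)
         (asym : Asymmetric _<′_) where

  -- Sortedness lets the entries before index `j` pass the filter; asymmetry rejects the entry at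
  -- `j` and all later ones. This turns an edge exponent into a count.
  index≡#preceding : ∀ {xs} → AllPairs _<′_ xs → (j : Fin (length xs)) →
                     length (filter (_<′? List.lookup xs j) xs) ≡ toℕ j
  index≡#preceding {x ∷ xs} (x< ∷ _) zero = trans
    (cong length (filter-reject (_<′? x) {xs = xs} λ x<x → asym x<x x<x))
    (cong length (filter-none (_<′? x) (All.map (flip asym) x<)))
  index≡#preceding {x ∷ xs} (x< ∷ xs<) (suc j) = trans
    (cong length (filter-accept (_<′? List.lookup xs j) {xs = xs}
                   (All.lookup x< (∈-lookup j))))
    (cong suc (index≡#preceding xs< j))

-- Evaluates the row counts in `unfilled`. A general `g` stands for the identity so that the
-- induction can pass to `g ∘ suc`.
length-filter-initial :
  ∀ {A : Set} {P : A → Set} (P? : Decidable P) {m} a (g : Fin m → A) → a ≤ m →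
  (∀ c → toℕ c < a → P (g c)) → (∀ c → a ≤ toℕ c → ¬ P (g c)) →
  length (filter P? (List.tabulate g)) ≡ a
length-filter-initial P? zero g _ _ out =
  cong length (filter-none P? (All.tabulate⁺ λ c → out c z≤n))
length-filter-initial P? {suc m} (suc a) g (s≤s a≤m) in′ out = trans
  (cong length (filter-accept P? (in′ zero z<s)))
  (cong suc (length-filter-initial P? a (g ∘ suc) a≤m
    (λ c c<a → in′ (suc c) (s<s c<a)) (λ c a≤c → out (suc c) (s≤s a≤c))))

-- Exponents in products of monomials

x-same : ∀ j e → (x[ j ]^ e) j ≡ e
x-same j e with j ≟ j
... | yes _  = refl
... | no j≢j = contradiction refl j≢j

x-other : ∀ {i j} e → i ≢ j → (x[ j ]^ e) i ≡ 0
x-other {i} {j} e i≢j with i ≟ j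
... | yes i≡j = contradiction i≡j i≢j
... | no _    = refl

module _ (g : ℕ → ℕ) where

  ∏-∉ : ∀ {i} js → i ∉ js → ∏ (List.map (λ j → x[ j ]^ g j) js) i ≡ 0
  ∏-∉ []       _   = refl
  ∏-∉ (j ∷ js) i∉ =
    cong₂ _+_ (x-other (g j) (i∉ ∘ here)) (∏-∉ js (i∉ ∘ there))

  ∏-∈ : ∀ {i js} → Unique js → i ∈ js → ∏ (List.map (λ j → x[ j ]^ g j) js) i ≡ g i
  ∏-∈ {i} {js = j ∷ js} (j∉js ∷ _) (here refl) = trans
    (cong₂ _+_ (x-same i (g i)) (∏-∉ js λ i∈js → All.lookup j∉js i∈js refl))
    (+-identityʳ (g i))
  ∏-∈ {js = j ∷ js} (j∉js ∷ js!) (there i∈js) =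
    cong₂ _+_ (x-other (g j) (≢-sym (All.lookup j∉js i∈js))) (∏-∈ js! i∈js)

-- Compositions and the dimension-ordering

lookup≤sum : ∀ {k} (α : Composition k) r → lookup α r ≤ sum α
lookup≤sum (a ∷ α) zero    = m≤m+n a (sum α)
lookup≤sum (a ∷ α) (suc r) = ≤-trans (lookup≤sum α r) (m≤n+m (sum α) a)

sum-≔ : ∀ {k} (α : Composition k) r {c} → suc c ≡ lookup α r →
        suc (sum (α [ r ]≔ c)) ≡ sum α
sum-≔ (a ∷ α) zero    refl = refl
sum-≔ (a ∷ α) (suc r) eq   =
  trans (sym (+-suc a _)) (cong (a +_) (sum-≔ α r eq))

infix 4 _≺_ _≺?_

-- The order in which far-right boxes are labelled. On positions of boxes it unfolds to the very
-- position condition of `IsDimensionPair`.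
_≺_ : ∀ {k} → Rel (Fin k × ℕ) 0ℓ
(r , c) ≺ (r′ , c′) = (c′ ≡ c × r Fin.< r′) ⊎ c′ < c

_≺?_ : ∀ {k} → Binary.Decidable (_≺_ {k})
(r , c) ≺? (r′ , c′) = ((c′ ≟ c) ×-dec (r Fin.<? r′)) ⊎-dec (c′ <? c)

≺-asym : ∀ {k} → Asymmetric (_≺_ {k})
≺-asym (inj₁ (_ , r<r′))    (inj₁ (_ , r′<r)) = <-asym r<r′ r′<r
≺-asym (inj₁ (refl , _))    (inj₂ c<c)        = <-irrefl refl c<c
≺-asym (inj₂ c<c)           (inj₁ (refl , _)) = <-irrefl refl c<c
≺-asym (inj₂ c′<c)          (inj₂ c<c′)       = <-asym c<c′ c′<c

≺⇒≢ : ∀ {k} {p q : Fin k × ℕ} → p ≺ q → p ≢ q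
≺⇒≢ p≺p refl = ≺-asym p≺p p≺p

module _ {k} (α : Composition k) where

  private
    inColumn : ℕ → List (Fin k × ℕ)
    inColumn c = List.map (_, c) (filter (λ r → lookup α r ≟ suc c) (allFin k))

  ∈-dimensionOrdering⁺ : ∀ {r c} → suc c ≡ lookup α r → (r , c) ∈ dimensionOrdering α
  ∈-dimensionOrdering⁺ {r} {c} eq = ∈-concatMap⁺ inColumn (lose
    (∈-downFrom⁺ (≤-trans (≤-reflexive eq) (lookup≤sum α r)))
    (∈-map⁺ (_, c) (∈-filter⁺ (λ r → lookup α r ≟ suc c) (∈-allFin r) (sym eq))))

  ∈-dimensionOrdering⁻ : ∀ {r c} → (r , c) ∈ dimensionOrdering α → suc c ≡ lookup α r
  ∈-dimensionOrdering⁻ p∈ with find (∈-concatMap⁻ inColumn {xs = downFrom (sum α)} p∈)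
  ... | c , _ , p∈c with ∈-map⁻ (_, c) p∈c
  ... | r , r∈ , refl = sym (proj₂ (∈-filter⁻ (λ r → lookup α r ≟ suc c) {xs = allFin k} r∈))

  -- Within a column `allFin` lists the rows from the top, which gives the first case of `≺`;
  -- `downFrom` lists the columns from right to left, which gives the second.
  dimensionOrdering-sorted : AllPairs _≺_ (dimensionOrdering α)
  dimensionOrdering-sorted = AllPairs.concat⁺
    (All.map⁺ (All.tabulate λ {c} _ → AllPairs.map⁺ (AllPairs.filter⁺ _
      (AllPairs.tabulate⁺-< λ r<r′ → inj₁ (refl , r<r′)))))
    (AllPairs.map⁺ (AllPairs.applyDownFrom⁺₁ id (sum α) λ c′<c _ →
      All.map⁺ (All.tabulate λ _ → All.map⁺ (All.tabulate λ _ → inj₂ c′<c))))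

-- Fillings arising in the tree

module _ {k} {μ : Composition k} where

  position-injective : {b b′ : Box μ} → position b ≡ position b′ → b ≡ b′
  position-injective {box r c} {box r′ c′} eq with cong proj₁ eq
  ... | refl = cong (box r) (Fin.toℕ-injective (cong proj₂ eq))

  boxAt : ∀ {r c} → c < lookup μ r → Σ[ b ∈ Box μ ] position b ≡ (r , c)
  boxAt {r} c<μr = box r (fromℕ< c<μr) , cong (r ,_) (Fin.toℕ-fromℕ< c<μr)

  module _ {v : ℕ} {p : Fin k × ℕ} {f : PartialFilling μ} where

    place-at : ∀ b → position b ≡ p → place v p f b ≡ just v
    place-at b eq with ≡-dec Fin._≟_ _≟_ (position b) p
    ... | yes _  = refl
    ... | no neq = contradiction eq neq

    place-off : ∀ b → position b ≢ p → place v p f b ≡ f b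
    place-off b neq with ≡-dec Fin._≟_ _≟_ (position b) p
    ... | yes eq = contradiction eq neq
    ... | no _   = refl

    place-just : ∀ b {w} → place v p f b ≡ just w →
                 (position b ≡ p × v ≡ w) ⊎ f b ≡ just w
    place-just b eq with ≡-dec Fin._≟_ _≟_ (position b) p
    ... | yes at = inj₁ (at , just-injective eq)
    ... | no _   = inj₂ eq

  -- f is filled with i + 1, …, n, and its unfilled boxes form α.
  record IsFillingAbove (n i : ℕ) (α : Composition k) (f : PartialFilling μ) : Set where
    field
      level≤     : i ≤ n
      sum≡level  : sum α ≡ i
      bounded    : ∀ r → lookup α r ≤ lookup μ r
      empty      : ∀ b → col b < lookup α (row b) → f b ≡ nothing
      filled     : ∀ b → lookup α (row b) ≤ col b → ∃[ w ] f b ≡ just w × i < w × w ≤ n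
      injective  : ∀ b b′ {w} → f b ≡ just w → f b′ ≡ just w → b ≡ b′
      surjective : ∀ w → i < w → w ≤ n → ∃[ b ] f b ≡ just w
      row-strict : ∀ r {c d} → c Fin.< d → ∀ {w w′} →
                   f (box r c) ≡ just w → f (box r d) ≡ just w′ → w < w′

    range : ∀ b {w} → f b ≡ just w → lookup α (row b) ≤ col b × i < w × w ≤ n
    range b eq with lookup α (row b) ≤? col b
    ... | no α≰c = contradiction (trans (sym (empty b (≰⇒> α≰c))) eq) λ ()
    ... | yes α≤c with filled b α≤c
    ... | w , eq′ , i<w , w≤n with just-injective (trans (sym eq) eq′)
    ... | refl = α≤c , i<w , w≤n

    -- Since `f` determines `α`, the invariant can be proved for an explicit composition and then
    -- moved to `unfilled f`, which the constructor `child` mentions.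
    unfilled≡ : unfilled f ≡ α
    unfilled≡ = trans (tabulate-cong λ r → length-filter-initial
        (λ c → T? (is-nothing (f (box r c)))) (lookup α r) id (bounded r)
        (λ c c<α → isNothing (empty (box r c) c<α))
        (λ c α≤c → isJust (proj₁ (proj₂ (filled (box r c) α≤c)))))
      (tabulate∘lookup α)
      where
      isNothing : ∀ {m : Maybe ℕ} → m ≡ nothing → T (is-nothing m)
      isNothing refl = tt
      isJust : ∀ {m : Maybe ℕ} {w} → m ≡ just w → ¬ T (is-nothing m)
      isJust refl ()

  module _ {n i α} {f : PartialFilling μ} (F : IsFillingAbove n (suc i) α f)
           {r c} (corner : suc c ≡ lookup α r) where

    private
      module F = IsFillingAbove F

      f′ : PartialFilling μ
      f′ = place (suc i) (r , c) f

      -- Columns count from 0: removing the box in column `c` from a row of length `suc c` leaves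
      -- `c` boxes.
      α′ : Composition k
      α′ = α [ r ]≔ c

      q : Box μ
      q = proj₁ (boxAt (≤-trans (≤-reflexive corner) (F.bounded r)))

      q-position : position q ≡ (r , c)
      q-position = proj₂ (boxAt (≤-trans (≤-reflexive corner) (F.bounded r)))

      α′≤α : ∀ s → lookup α′ s ≤ lookup α s
      α′≤α s with s Fin.≟ r
      ... | yes refl = ≤-trans (≤-reflexive (lookup∘update r α c))
                               (≤-trans (n≤1+n c) (≤-reflexive corner))
      ... | no s≢r   = ≤-reflexive (lookup∘update′ s≢r α c)

      filled⇒off : ∀ (b : Box μ) → lookup α (row b) ≤ col b → position b ≢ (r , c)
      filled⇒off b α≤c refl = <-irrefl refl (≤-trans (≤-reflexive corner) α≤c)

      empty′ : ∀ b → col b < lookup α′ (row b) → f′ b ≡ nothing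
      empty′ b c<α′ = trans (place-off b off) (F.empty b (≤-trans c<α′ (α′≤α (row b))))
        where
        off : position b ≢ (r , c)
        off refl = <-irrefl (sym (lookup∘update r α c)) c<α′

      old : ∀ b → lookup α (row b) ≤ col b → ∃[ w ] f′ b ≡ just w × i < w × w ≤ n
      old b α≤c with F.filled b α≤c
      ... | w , eq , i<w , w≤n = w , trans (place-off b (filled⇒off b α≤c)) eq , <⇒≤ i<w , w≤n

      filled′ : ∀ b → lookup α′ (row b) ≤ col b → ∃[ w ] f′ b ≡ just w × i < w × w ≤ n
      filled′ b α′≤c = cases (≡-dec Fin._≟_ _≟_ (position b) (r , c)) (row b Fin.≟ r)
        where
        cases : Dec (position b ≡ (r , c)) → Dec (row b ≡ r) →
                ∃[ w ] f′ b ≡ just w × i < w × w ≤ n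
        cases (yes at) _          = suc i , place-at b at , n<1+n i , F.level≤
        cases (no _)   (no b≢r)   =
          old b (≤-trans (≤-reflexive (sym (lookup∘update′ b≢r α c))) α′≤c)
        -- In row `r` away from the corner, `c ≤ col b` and `col b ≢ c` give `suc c ≤ col b`, so the
        -- box was filled before.
        cases (no off) (yes refl) =
          old b (≤-trans (≤-reflexive (sym corner)) (≤∧≢⇒<
            (≤-trans (≤-reflexive (sym (lookup∘update r α c))) α′≤c)
            (λ c≡ → off (cong (r ,_) (sym c≡)))))

      injective′ : ∀ b b′ {w} → f′ b ≡ just w → f′ b′ ≡ just w → b ≡ b′
      injective′ b b′ eq eq′ with place-just b eq | place-just b′ eq′
      ... | inj₁ (at , _)  | inj₁ (at′ , _) = position-injective (trans at (sym at′))
      ... | inj₁ (_ , refl) | inj₂ o′       = contradiction (proj₁ (proj₂ (F.range b′ o′))) (<-irrefl refl)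
      ... | inj₂ o | inj₁ (_ , refl)        = contradiction (proj₁ (proj₂ (F.range b o))) (<-irrefl refl)
      ... | inj₂ o | inj₂ o′                = F.injective b b′ o o′

      surjective′ : ∀ w → i < w → w ≤ n → ∃[ b ] f′ b ≡ just w
      surjective′ w i<w w≤n with m≤n⇒m<n∨m≡n i<w
      ... | inj₂ refl = q , place-at q q-position
      ... | inj₁ si<w with F.surjective w si<w w≤n
      ... | b , eq = b , trans (place-off b (filled⇒off b (proj₁ (F.range b eq)))) eq

      row-strict′ : ∀ s {x y} → x Fin.< y → ∀ {w w′} →
                    f′ (box s x) ≡ just w → f′ (box s y) ≡ just w′ → w < w′
      row-strict′ s {x} {y} x<y eq eq′ with place-just (box s x) eq | place-just (box s y) eq′
      ... | inj₁ (at , _) | inj₁ (at′ , _) =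
              contradiction x<y (<-irrefl (cong proj₂ (trans at (sym at′))))
      ... | inj₁ (_ , refl) | inj₂ o′ = proj₁ (proj₂ (F.range (box s y) o′))
      -- Box `x`, left of the corner, cannot hold a value yet: filled boxes of this row start at
      -- column `suc c`.
      ... | inj₂ o | inj₁ (refl , _)  = contradiction
              (≤-trans (≤-reflexive corner) (proj₁ (F.range (box s x) o)))
              (<⇒≱ (<-trans x<y (n<1+n _)))
      ... | inj₂ o | inj₂ o′ = F.row-strict s x<y o o′

    -- The corner ends the unfilled part of its row, so what is left stays left-justified; `suc i`
    -- is smaller than all values placed before, so rows stay increasing and values distinct.
    place-isFillingAbove : IsFillingAbove n i α′ f′
    place-isFillingAbove = record
      { level≤     = <⇒≤ F.level≤
      ; sum≡level  = suc-injective (trans (sum-≔ α r corner) F.sum≡level)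
      ; bounded    = λ s → ≤-trans (α′≤α s) (F.bounded s)
      ; empty      = empty′
      ; filled     = filled′
      ; injective  = injective′
      ; surjective = surjective′
      ; row-strict = row-strict′
      }

  root-isFillingAbove : ∀ {n} → sum μ ≡ n → IsFillingAbove n n μ (λ _ → nothing)
  root-isFillingAbove sum≡n = record
    { level≤     = ≤-refl
    ; sum≡level  = sum≡n
    ; bounded    = λ _ → ≤-refl
    ; empty      = λ _ _ → refl
    ; filled     = λ b μ≤c → contradiction (Fin.toℕ<n (column b)) (≤⇒≯ μ≤c)
    ; injective  = λ _ _ ()
    ; surjective = λ w n<w w≤n → contradiction w≤n (<⇒≱ n<w)
    ; row-strict = λ _ _ ()
    }

  unfilled-isFillingAbove : ∀ {n i α} {f : PartialFilling μ} →
    IsFillingAbove n i α f → IsFillingAbove n i (unfilled f) f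
  unfilled-isFillingAbove F =
    subst (λ α → IsFillingAbove _ _ α _) (sym (IsFillingAbove.unfilled≡ F)) F

  -- Induction along the path: the box chosen by an edge is an entry of the dimension-ordering,
  -- hence the last unfilled box of its row.
  vertex-isFillingAbove : ∀ {n i f} → sum μ ≡ n → Vertex n μ i f →
                          IsFillingAbove n i (unfilled f) f
  vertex-isFillingAbove sum≡n root = unfilled-isFillingAbove (root-isFillingAbove sum≡n)
  vertex-isFillingAbove sum≡n (child {f = f} v j) = unfilled-isFillingAbove
    (place-isFillingAbove (vertex-isFillingAbove sum≡n v)
      (∈-dimensionOrdering⁻ (unfilled f) (∈-lookup j)))

  module _ {n α} {f : PartialFilling μ} (F : IsFillingAbove n 0 α f) where

    private module F = IsFillingAbove F

    complete : ∀ b → ∃[ w ] f b ≡ just w × 0 < w × w ≤ n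
    -- The unfilled rows have total length 0, so every column lies beyond them.
    complete b = F.filled b (≤-trans
      (≤-trans (lookup≤sum α (row b)) (≤-reflexive F.sum≡level)) z≤n)

    completion : Filling μ
    completion b = proj₁ (complete b)

    completion-just : ∀ b → f b ≡ just (completion b)
    completion-just b = proj₁ (proj₂ (complete b))

    completion-isRowStrict : IsRowStrictFilling n completion
    completion-isRowStrict = record
      { in-range   = λ b → proj₂ (proj₂ (complete b))
      ; injective  = λ {b} {b′} eq → F.injective b b′ (completion-just b)
          (trans (completion-just b′) (cong just (sym eq)))
      ; surjective = λ v 1≤v v≤n → let b , eq = F.surjective v 1≤v v≤n in
          b , just-injective (trans (sym (completion-just b)) eq)
      ; row-strict = λ r c<d → F.row-strict r c<d (completion-just _) (completion-just _)
      }

-- Dimension pairs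

module _ {k} {μ : Composition k} {n} {T : Filling μ} (T-rs : IsRowStrictFilling n T) where

  open IsRowStrictFilling T-rs

  -- Snapshot of the tree just before `T q` is placed: `α` is the unfilled part, which will receive
  -- values at most `T q`, and all boxes outside it carry larger values.
  module _ (α : Composition k) (bounded : ∀ r → lookup α r ≤ lookup μ r)
           {q} (below : ∀ b → col b < lookup α (row b) → T b ≤ T q)
           (above : ∀ b → lookup α (row b) ≤ col b → T q < T b) where

    private
      preceding : List (Fin k × ℕ)
      preceding = filter (_≺? position q) (dimensionOrdering α)

      -- Matches a far-right box with the pair formed by its value and `T q`. Injectivity of `T` and
      -- of `position` makes the matching one-to-one.
      Holds : Fin k × ℕ → ℕ × ℕ → Set
      Holds p (a , b) = (∃[ s ] position s ≡ p × T s ≡ a) × b ≡ T q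

      Holds-injectiveˡ : ∀ {p p′ y} → Holds p y → Holds p′ y → p ≡ p′
      Holds-injectiveˡ ((s , refl , refl) , _) ((s′ , refl , eq) , _) =
        cong position (injective (sym eq))

      Holds-injectiveʳ : ∀ {y y′ p} → Holds p y → Holds p y′ → y ≡ y′
      Holds-injectiveʳ ((s , refl , refl) , refl) ((s′ , eq , refl) , refl) =
        cong (λ s → T s , T q) (position-injective (sym eq))

      preceding⇒D : ∀ {p} → p ∈ preceding → ∃[ y ] y ∈ D T n (T q) × Holds p y
      preceding⇒D {r , c} p∈ with ∈-filter⁻ (_≺? position q) {xs = dimensionOrdering α} p∈
      ... | p∈α , p≺q with ∈-dimensionOrdering⁻ α p∈α
      ... | corner with boxAt {μ = μ} (≤-trans (≤-reflexive corner) (bounded r))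
      ... | s , refl = (T s , T q) , ∈-filter⁺ (isDimensionPair? T)
          (∈-map⁺ (_, T q) (in-interval (in-range s)))
          (s , q , refl , refl , Ts<Tq , p≺q , right) , (s , refl , refl) , refl
        where
        in-interval : ∀ {a} → 1 ≤ a × a ≤ n → a ∈ [ 1 ⋯ n ]
        in-interval {suc a} (_ , a<n) = ∈-applyUpTo⁺ suc a<n
        Ts<Tq : T s < T q
        Ts<Tq = ≤∧≢⇒< (below s (≤-reflexive corner))
                      (λ eq → ≺⇒≢ p≺q (cong position (injective eq)))
        -- The right neighbour of a far-right box is the first box of its row outside `α`, so its
        -- value exceeds `T q`.
        right : ∀ t → position t ≡ (row s , suc (col s)) → T q ≤ T t
        right t eq = <⇒≤ (above t (subst (λ p → lookup α (proj₁ p) ≤ proj₂ p) (sym eq)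
                                          (≤-reflexive (sym corner))))

      D⇒preceding : ∀ {y} → y ∈ D T n (T q) → ∃[ p ] p ∈ preceding × Holds p y
      D⇒preceding y∈ with ∈-filter⁻ (isDimensionPair? T) {xs = List.map (_, T q) [ 1 ⋯ n ]} y∈
      ... | y∈map , pair with ∈-map⁻ (_, T q) y∈map
      D⇒preceding y∈ | y∈map , (s , q′ , refl , Tq′≡Tq , Ts<Tq , s≺q′ , right) | a , _ , refl
        with injective Tq′≡Tq
      ... | refl = position s ,
          ∈-filter⁺ (_≺? position q) (∈-dimensionOrdering⁺ α corner) s≺q′ ,
          (s , refl , refl) , refl
        where
        inside : col s < lookup α (row s)
        inside = ≰⇒> λ α≤c → <-asym Ts<Tq (above s α≤c)
        -- If `s` were not far-right, its right neighbour `t` would be unfilled, so `T t ≤ T q`,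
        -- while the dimension pair gives `T q ≤ T t`. Then `t` is `q`, which puts `q` to the right
        -- of `s`, against `s ≺ q`.
        corner : suc (col s) ≡ lookup α (row s)
        corner with m≤n⇒m<n∨m≡n inside
        ... | inj₂ eq = eq
        ... | inj₁ sc<α with boxAt {μ = μ} (≤-trans sc<α (bounded (row s)))
        ... | t , eq with injective (≤-antisym
                            (below t (subst (λ p → proj₂ p < lookup α (proj₁ p)) (sym eq) sc<α))
                            (right t eq))
        ... | refl = contradiction (inj₂ (≤-reflexive (cong proj₂ (sym eq)))) (≺-asym s≺q′)

    -- The matching is used in both directions between lists without repetitions; the
    -- dimension-ordering has none because it is sorted by the irreflexive `≺`.
    |D|≡#preceding : length (D T n (T q)) ≡
                     length (filter (_≺? position q) (dimensionOrdering α))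
    |D|≡#preceding = ≤-antisym
      (length-≤ (flip Holds) Holds-injectiveʳ
        (Unique.filter⁺ (isDimensionPair? T) (Unique.map⁺ (cong proj₁)
          (Unique.applyUpTo⁺₁ suc n λ i<j _ eq → <-irrefl (suc-injective eq) i<j)))
        D⇒preceding)
      (length-≤ Holds Holds-injectiveˡ
        (AllPairs.map ≺⇒≢ (AllPairs.filter⁺ (_≺? position q) (dimensionOrdering-sorted α)))
        preceding⇒D)

  -- The tree has an edge for the value 1, but `Φ` starts at 2. No entry lies below 1, so the
  -- exponents of `x₁` can still agree.
  |D₁|≡0 : length (D T n 1) ≡ 0
  |D₁|≡0 = cong length (filter-none (isDimensionPair? T) {xs = List.map (_, 1) [ 1 ⋯ n ]}
    (All.map⁺ (All.tabulate λ { _ (s , _ , refl , _ , Ts<1 , _) →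
      <-irrefl refl (≤-trans Ts<1 (proj₁ (in-range s))) })))

  Φ-below : ∀ {w} → w ≤ 1 → Φ T n w ≡ 0
  Φ-below w≤1 = ∏-∉ _ [ 2 ⋯ n ] λ w∈ → let i , _ , eq = ∈-applyUpTo⁻ (2 +_) w∈ in
    <-irrefl refl (≤-trans (s≤s (s≤s z≤n)) (≤-trans (≤-reflexive (sym eq)) w≤1))

  Φ-above : ∀ {w} → n < w → Φ T n w ≡ 0
  Φ-above {w} n<w = ∏-∉ _ [ 2 ⋯ n ] λ w∈ → outside n<w (∈-applyUpTo⁻ (2 +_) w∈)
    where
    outside : ∀ {m w} → m < w → ¬ (∃[ i ] i < suc m ∸ 2 × w ≡ 2 + i)
    outside {suc m} m<w (i , i<m , refl) = <-irrefl refl (≤-trans m<w (s≤s i<m))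

  Φ-inside : ∀ {w} → 1 ≤ w → w ≤ n → Φ T n w ≡ length (D T n w)
  Φ-inside {suc zero}    _ _           = trans (Φ-below ≤-refl) (sym |D₁|≡0)
  Φ-inside {suc (suc w)} _ w<n = ∏-∈ _
    (Unique.applyUpTo⁺₁ (2 +_) (suc n ∸ 2) λ i<j _ eq →
      <-irrefl (suc-injective (suc-injective eq)) i<j)
    (∈-applyUpTo⁺ (2 +_) (∸-monoˡ-≤ 1 w<n))

-- Path labels of the tree

module _ {k} {μ : Composition k} where

  -- `T` is the final filling, kept fixed while the induction climbs from Level 0 to the root; at
  -- Level `i` the values still to be placed are at most `i`.
  Extends : ℕ → PartialFilling μ → Filling μ → Set
  Extends i f T = (∀ b {w} → f b ≡ just w → T b ≡ w) × (∀ b → f b ≡ nothing → T b ≤ i)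

  level≤ : ∀ {n i f} → Vertex n μ i f → i ≤ n
  level≤ root        = ≤-refl
  level≤ (child v _) = <⇒≤ (level≤ v)

  -- Edges between the root and Level `i` carry only variables with indices from `i + 1` to `n`;
  -- this lemma and the next one clear the exponents on either side.
  pathLabel-above : ∀ {n i f} (v : Vertex n μ i f) {w} → n < w → pathLabel v w ≡ 0
  pathLabel-above root        _   = refl
  pathLabel-above (child v j) n<w = cong₂ _+_ (pathLabel-above v n<w)
    (x-other (toℕ j) λ { refl → <⇒≱ n<w (level≤ v) })

  pathLabel-below : ∀ {n i f} (v : Vertex n μ i f) {w} → w ≤ i → pathLabel v w ≡ 0
  pathLabel-below root        _   = refl
  pathLabel-below (child v j) w≤i = cong₂ _+_ (pathLabel-below v (m≤n⇒m≤1+n w≤i))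
    (x-other (toℕ j) λ { refl → <-irrefl refl w≤i })

  module _ {n} {T : Filling μ} (sum≡n : sum μ ≡ n) (T-rs : IsRowStrictFilling n T) where

    -- The snapshot is taken at the parent `v`: `j` counts the far-right boxes preceding the chosen
    -- one, and these match the pairs `(a , suc i)`.
    label≡|D| : ∀ {i f} → Vertex n μ (suc i) f →
      (j : Fin (length (dimensionOrdering (unfilled f)))) → Extends (suc i) f T →
      (∀ q → position q ≡ List.lookup (dimensionOrdering (unfilled f)) j → T q ≡ suc i) →
      toℕ j ≡ length (D T n (suc i))
    label≡|D| {i} {f} v j (just⇒ , nothing⇒) placed =
      let q , q-position = boxAt {μ = μ} {r = proj₁ p} {c = proj₂ p} (≤-trans
                             (≤-reflexive (∈-dimensionOrdering⁻ α (∈-lookup j)))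
                             (F.bounded (proj₁ p)))
          Tq≡ = placed q q-position
      in begin
        toℕ j
          ≡⟨ index≡#preceding _≺?_ ≺-asym (dimensionOrdering-sorted α) j ⟨
        length (filter (_≺? p) (dimensionOrdering α))
          ≡⟨ cong (λ p → length (filter (_≺? p) (dimensionOrdering α))) q-position ⟨
        length (filter (_≺? position q) (dimensionOrdering α))
          ≡⟨ |D|≡#preceding T-rs α F.bounded
               (λ b c<α → subst (T b ≤_) (sym Tq≡) (nothing⇒ b (F.empty b c<α)))
               (λ b α≤c → subst (_< T b) (sym Tq≡) (above b (F.filled b α≤c))) ⟨
        length (D T n (T q))
          ≡⟨ cong (λ w → length (D T n w)) Tq≡ ⟩
        length (D T n (suc i)) ∎
      where
      open ≡-Reasoning
      α = unfilled f
      p = List.lookup (dimensionOrdering α) j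
      module F = IsFillingAbove (vertex-isFillingAbove sum≡n v)
      above : ∀ b → ∃[ w ] f b ≡ just w × suc i < w × w ≤ n → suc i < T b
      above b (w , eq , i<w , _) = subst (suc i <_) (sym (just⇒ b eq)) i<w

    -- Each variable occurs on a single edge. The induction climbs to the edge for `w`, and all
    -- others contribute 0.
    pathLabel≡|D| : ∀ {i f} (v : Vertex n μ i f) → Extends i f T →
                    ∀ {w} → i < w → w ≤ n → pathLabel v w ≡ length (D T n w)
    pathLabel≡|D| root _ n<w w≤n = contradiction w≤n (<⇒≱ n<w)
    pathLabel≡|D| {i} (child {f = f} v j) (just⇒ , nothing⇒) {w} i<w w≤n =
      step (m≤n⇒m<n∨m≡n i<w)
      where
      p = List.lookup (dimensionOrdering (unfilled f)) j

      off : ∀ b {m} → f b ≡ m → position b ≢ p → place (suc i) p f b ≡ m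
      off b eq neq = trans (place-off b neq) eq

      placed : ∀ b → position b ≡ p → T b ≡ suc i
      placed b at = just⇒ b (place-at b at)

      f⊆T : Extends (suc i) f T
      proj₁ f⊆T b eq with ≡-dec Fin._≟_ _≟_ (position b) p
      ... | no neq = just⇒ b (off b eq neq)
      -- The box filled by this edge was still empty in `f`.
      ... | yes at = contradiction (trans (sym eq) (F.empty b corner)) λ ()
        where
        module F = IsFillingAbove (vertex-isFillingAbove sum≡n v)
        corner : col b < lookup (unfilled f) (row b)
        corner = ≤-reflexive (∈-dimensionOrdering⁻ (unfilled f)
          (subst (_∈ dimensionOrdering (unfilled f)) (sym at) (∈-lookup j)))
      proj₂ f⊆T b eq with ≡-dec Fin._≟_ _≟_ (position b) p
      ... | no neq = m≤n⇒m≤1+n (nothing⇒ b (off b eq neq))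
      -- This box becomes unfilled one level up and holds `suc i`, exactly the new bound.
      ... | yes at = ≤-reflexive (placed b at)

      step : suc i < w ⊎ suc i ≡ w →
             pathLabel v w + (x[ suc i ]^ toℕ j) w ≡ length (D T n w)
      step (inj₁ si<w) = trans
        (cong₂ _+_ (pathLabel≡|D| v f⊆T si<w w≤n)
                   (x-other (toℕ j) λ { refl → <-irrefl refl si<w }))
        (+-identityʳ _)
      step (inj₂ refl) = trans
        (cong₂ _+_ (pathLabel-below v ≤-refl) (x-same (suc i) (toℕ j)))
        (label≡|D| v j f⊆T placed)

    -- For indices from 1 to `n` both exponents count dimension pairs; elsewhere both vanish.
    Φ≗pathLabel : ∀ {f} (v : Vertex n μ 0 f) → Extends 0 f T → Φ T n ≗ pathLabel v
    Φ≗pathLabel v ext zero = trans (Φ-below T-rs z≤n) (sym (pathLabel-below v z≤n))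
    Φ≗pathLabel v ext w@(suc _) with w ≤? n
    ... | yes w≤n = trans (Φ-inside T-rs z<s w≤n) (sym (pathLabel≡|D| v ext z<s w≤n))
    ... | no w≰n  = trans (Φ-above T-rs (≰⇒> w≰n)) (sym (pathLabel-above v (≰⇒> w≰n)))

-- Level 0 fillings and their leaf labels

mainTheorem6 : ∀ {k} (n : ℕ) (μ : Composition k) → IsPartition n μ →
    ∀ {f} (v : Vertex n μ 0 f) →
    Σ[ T ∈ Filling μ ]
    ((∀ b → f b ≡ just (T b)) ×
    IsRowStrictFilling n T ×
    Φ T n ≗ leafLabel v)
mainTheorem6 n μ μ-partition {f} v =
  completion F , completion-just F , completion-isRowStrict F , λ w → trans
    (Φ≗pathLabel sum≡n (completion-isRowStrict F) v (just⇒ , nothing⇒) w)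
    -- The last edge, labelled `1`, adds 0 to each exponent.
    (sym (+-identityʳ (pathLabel v w)))
  where
  sum≡n = IsPartition.sums-to μ-partition
  F = vertex-isFillingAbove sum≡n v

  just⇒ : ∀ b {w} → f b ≡ just w → completion F b ≡ w
  just⇒ b eq = just-injective (trans (sym (completion-just F b)) eq)

  -- No box is unfilled at Level 0, so the bound holds vacuously.
  nothing⇒ : ∀ b → f b ≡ nothing → completion F b ≤ 0
  nothing⇒ b eq = contradiction (trans (sym (completion-just F b)) eq) λ ()
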